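{- Let $G=(V,E)$ be a finite simple graph with $V\neq\emptyset$ and $E\neq\emptyset$, and fix $e\in E$. For $i\geq 1$ let $$b_e^i(G)=\sum_{F\in\mathcal{B}_e^i}(-1)^{|F|},$$ where $\mathcal{B}_e^i$ is the collection of all $F\subseteq E$ such that $e$ is a bridge in $F$ and $k(F)=i$. Then for $i=1,2,3,\dots$, $$b_e^i(G)=-\sum_{\substack{V=V_1\sqcup\cdots\sqcup V_{i+1}\\ e\notin G[V_j],\ j=1,\dots,i+1}}\ \prod_{j=1}^{i+1}a_1(G[V_j]),$$ where the sum is over all (unordered) decompositions of $V$ into $i+1$ non-empty disjoint subsets $V_1,\dots,V_{i+1}$ such that $e$ is not an edge of any $G[V_j]$.
   Context: For $F\subseteq E$, $k(F)$ denotes the number of connected components of the spanning subgraph $(V,F)$ (isolated vertices count as components). An edge $e$ is a bridge in $F$ if $e\in F$ and $k(F\setminus\{e\})=k(F)+1$. For non-empty $V'\subseteq V$, $G[V']$ is the subgraph of $G$ induced by $V'$. For any finite simple graph $G'=(V',E')$, $a_1(G')=\sum_{F\subseteq E',\,k(F)=1}(-1)^{|F|}$, where $k(F)$ is the number of connected components of $(V',F)$; this is the coefficient of $\lambda$ in the chromatic polynomial of $G'$. An empty sum is $0$. -}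

module Defs where

open import Data.Nat as ℕ using (ℕ; suc)
open import Data.Integer using (ℤ; 0ℤ; 1ℤ; -1ℤ; _+_; _*_; _^_)
open import Data.Fin using (Fin; _<_)
open import Data.Fin.Properties using (_≟_; any?; all?)
open import Data.Fin.Subset as Subset using (Subset; inside; outside; Nonempty; Empty; _∩_; ⋃)
open import Data.Fin.Subset.Properties using (_∈?_; nonempty?)
open import Data.Bool.Properties using () renaming (_≟_ to _≟ᵇ_)
open import Data.List using (List; []; _∷_; _++_; map; foldr; filter; length)
open import Data.List.Membership.Propositional using (_∈_)
open import Data.List.Membership.Propositional.Properties using (∈-filter⁻)
import Data.List.Membership.DecPropositional as DecMembership
open import Data.List.Relation.Unary.All as All using (All)
open import Data.List.Relation.Unary.AllPairs as AllPairs using (AllPairs)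
open import Data.List.Relation.Unary.Any using (here; there)
open import Data.List.Relation.Unary.Unique.Propositional using (Unique)
open import Data.List.Relation.Unary.Unique.Propositional.Properties using (filter⁺)
open import Data.Product using (_×_; _,_; proj₁; proj₂; ∃-syntax)
open import Data.Product.Properties using () renaming (≡-dec to ×-≡-dec)
open import Data.Sum using (_⊎_; inj₁; inj₂)
open import Data.Vec using ([]; _∷_)
open import Data.Vec.Properties using () renaming (≡-dec to Vec-≡-dec)
open import Function using (_⇔_; mk⇔; Equivalence)
open import Relation.Binary.Construct.Closure.Equivalence using (EqClosure; gmap; transitive)
open import Relation.Binary.Construct.Closure.ReflexiveTransitive using (ε; _◅_)
open import Relation.Binary.Construct.Closure.Symmetric using (fwd; bwd)
open import Relation.Binary.Definitions using (Decidable; DecidableEquality)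
open import Relation.Binary.PropositionalEquality using (_≡_; refl)
open import Relation.Nullary using (Dec; ¬_; ¬?)
open import Relation.Nullary.Decidable using (map′; _×-dec_; _⊎-dec_; _→-dec_)
import Relation.Unary as U

∑ : {A : Set} → List A → (A → ℤ) → ℤ
∑ xs f = foldr _+_ 0ℤ (map f xs)

∏ : {A : Set} → List A → (A → ℤ) → ℤ
∏ xs f = foldr _*_ 1ℤ (map f xs)

-- For a duplicate-free list xs representing a finite set, the entries of
-- subsets xs represent the subsets of that set, each exactly once.
subsets : {A : Set} → List A → List (List A)
subsets []       = [] ∷ []
subsets (x ∷ xs) = map (x ∷_) (subsets xs) ++ subsets xs

allSubsets : ∀ n → List (Subset n)
allSubsets ℕ.zero  = [] ∷ []
allSubsets (suc n) = map (inside ∷_) (allSubsets n) ++ map (outside ∷_) (allSubsets n)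

-- The edge joining two distinct vertices is the pair listing them in
-- increasing order (enforced by Graph.E-valid), so that an unordered pair of
-- vertices has exactly one representation.
Edge : ℕ → Set
Edge n = Fin n × Fin n

_≟ₑ_ : ∀ {n} → DecidableEquality (Edge n)
_≟ₑ_ = ×-≡-dec _≟_ _≟_

_∈ₑ?_ : ∀ {n} → Decidable (_∈_ {A = Edge n})
_∈ₑ?_ = DecMembership._∈?_ _≟ₑ_

-- A finite simple graph; its vertex set is an arbitrary subset of Fin n, so
-- that induced subgraphs are again graphs over the same Fin n.
record Graph (n : ℕ) : Set where
  field
    V        : Subset n
    E        : List (Edge n)
    E-unique : Unique E
    E-valid  : ∀ {u v} → (u , v) ∈ E → u < v × u Subset.∈ V × v Subset.∈ V

open Graph public

_⊆ᵉ_ : ∀ {n} → Edge n → Subset n → Set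
(u , v) ⊆ᵉ S = u Subset.∈ S × v Subset.∈ S

_⊆ᵉ?_ : ∀ {n} → Decidable (_⊆ᵉ_ {n})
(u , v) ⊆ᵉ? S = (u ∈? S) ×-dec (v ∈? S)

-- The subgraph induced by S, for S ⊆ V G (not enforced).
_⟦_⟧ : ∀ {n} → Graph n → Subset n → Graph n
G ⟦ S ⟧ = record
  { V        = S
  ; E        = filter (_⊆ᵉ? S) (E G)
  ; E-unique = filter⁺ (_⊆ᵉ? S) (E-unique G)
  ; E-valid  = λ uv∈ → let uv∈E , uv⊆S = ∈-filter⁻ (_⊆ᵉ? S) uv∈
                       in proj₁ (E-valid G uv∈E) , uv⊆S
  }

-- Reachability over all of Fin n; since the edges of F have their endpoints in
-- the vertex set W, on W this is connectivity in the graph (W , F).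
Connected : ∀ {n} → List (Edge n) → Fin n → Fin n → Set
Connected F = EqClosure (λ u v → (u , v) ∈ F)

connected? : ∀ {n} (F : List (Edge n)) → Decidable (Connected F)
connected? {n} [] x y = map′ (λ { refl → ε }) to≡ (x ≟ y)
  where
  to≡ : ∀ {x y : Fin n} → Connected [] x y → x ≡ y
  to≡ ε             = refl
  to≡ (fwd () ◅ _)
  to≡ (bwd () ◅ _)
connected? {n} ((a , b) ∷ F) x y =
  map′ join split
    (connected? F x y
      ⊎-dec ((connected? F x a ×-dec connected? F b y)
      ⊎-dec (connected? F x b ×-dec connected? F a y)))
  where
  Split : Fin n → Set
  Split x = Connected F x y
          ⊎ (Connected F x a × Connected F b y)
          ⊎ (Connected F x b × Connected F a y)

  weaken : ∀ {u v} → Connected F u v → Connected ((a , b) ∷ F) u v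
  weaken = gmap (λ u → u) there

  infixr 5 _⨾_
  _⨾_ : ∀ {u v w} → Connected ((a , b) ∷ F) u v →
        Connected ((a , b) ∷ F) v w → Connected ((a , b) ∷ F) u w
  _⨾_ = transitive _

  join : ∀ {x} → Split x → Connected ((a , b) ∷ F) x y
  join (inj₁ p)              = weaken p
  join (inj₂ (inj₁ (p , q))) = weaken p ⨾ (fwd (here refl) ◅ weaken q)
  join (inj₂ (inj₂ (p , q))) = weaken p ⨾ (bwd (here refl) ◅ weaken q)

  split : ∀ {x} → Connected ((a , b) ∷ F) x y → Split x
  split ε = inj₁ ε
  split (fwd (here refl) ◅ r) with split r
  ... | inj₁ p              = inj₂ (inj₁ (ε , p))
  ... | inj₂ (inj₁ (_ , q)) = inj₂ (inj₁ (ε , q))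
  ... | inj₂ (inj₂ (_ , q)) = inj₁ q
  split (bwd (here refl) ◅ r) with split r
  ... | inj₁ p              = inj₂ (inj₂ (ε , p))
  ... | inj₂ (inj₁ (_ , q)) = inj₁ q
  ... | inj₂ (inj₂ (_ , q)) = inj₂ (inj₂ (ε , q))
  split (fwd (there s) ◅ r) with split r
  ... | inj₁ p              = inj₁ (fwd s ◅ p)
  ... | inj₂ (inj₁ (p , q)) = inj₂ (inj₁ (fwd s ◅ p , q))
  ... | inj₂ (inj₂ (p , q)) = inj₂ (inj₂ (fwd s ◅ p , q))
  split (bwd (there s) ◅ r) with split r
  ... | inj₁ p              = inj₁ (bwd s ◅ p)
  ... | inj₂ (inj₁ (p , q)) = inj₂ (inj₁ (bwd s ◅ p , q))
  ... | inj₂ (inj₂ (p , q)) = inj₂ (inj₂ (bwd s ◅ p , q))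

-- S is the vertex set of a connected component of the graph (W , F).
IsComponent : ∀ {n} → Subset n → List (Edge n) → Subset n → Set
IsComponent W F S =
  ∃[ v ] v Subset.∈ W × (∀ u → u Subset.∈ S ⇔ (u Subset.∈ W × Connected F v u))

isComponent? : ∀ {n} (W : Subset n) (F : List (Edge n)) → U.Decidable (IsComponent W F)
isComponent? W F S = any? λ v → (v ∈? W) ×-dec all? λ u →
  iff? (u ∈? S) ((u ∈? W) ×-dec connected? F v u)
  where
  iff? : {A B : Set} → Dec A → Dec B → Dec (A ⇔ B)
  iff? A? B? = map′ (λ (f , g) → mk⇔ f g)
                    (λ e → Equivalence.to e , Equivalence.from e)
                    ((A? →-dec B?) ×-dec (B? →-dec A?))

k : ∀ {n} → Subset n → List (Edge n) → ℕ
k {n} W F = length (filter (isComponent? W F) (allSubsets n))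

_∖_ : ∀ {n} → List (Edge n) → Edge n → List (Edge n)
F ∖ e = filter (λ f → ¬? (f ≟ₑ e)) F

IsBridge : ∀ {n} → Subset n → Edge n → List (Edge n) → Set
IsBridge W e F = e ∈ F × k W (F ∖ e) ≡ k W F ℕ.+ 1

isBridge? : ∀ {n} (W : Subset n) (e : Edge n) → U.Decidable (IsBridge W e)
isBridge? W e F = (e ∈ₑ? F) ×-dec (k W (F ∖ e) ℕ.≟ k W F ℕ.+ 1)

𝓑 : ∀ {n} → Graph n → Edge n → ℕ → List (List (Edge n))
𝓑 G e i = filter (λ F → isBridge? (V G) e F ×-dec (k (V G) F ℕ.≟ i)) (subsets (E G))

b : ∀ {n} → Graph n → Edge n → ℕ → ℤ
b G e i = ∑ (𝓑 G e i) λ F → -1ℤ ^ length F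

a₁ : ∀ {n} → Graph n → ℤ
a₁ G = ∑ (filter (λ F → k (V G) F ℕ.≟ 1) (subsets (E G))) λ F → -1ℤ ^ length F

record IsDecomposition {n} (W : Subset n) (m : ℕ) (P : List (Subset n)) : Set where
  constructor mkDecomposition
  field
    size     : length P ≡ m
    nonempty : All Nonempty P
    disjoint : AllPairs (λ S T → Empty (S ∩ T)) P
    cover    : ⋃ P ≡ W

isDecomposition? : ∀ {n} (W : Subset n) (m : ℕ) → U.Decidable (IsDecomposition W m)
isDecomposition? W m P =
  map′ (λ (s , n , d , c) → mkDecomposition s n d c)
       (λ D → let open IsDecomposition D in size , nonempty , disjoint , cover)
       ((length P ℕ.≟ m)
        ×-dec All.all? nonempty? P
        ×-dec AllPairs.allPairs? (λ S T → ¬? (nonempty? (S ∩ T))) P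
        ×-dec Vec-≡-dec _≟ᵇ_ (⋃ P) W)

-- Unordered decompositions: each set of blocks is listed once, namely as a
-- sublist of allSubsets n.
decompositions : ∀ {n} → Graph n → ℕ → Edge n → List (List (Subset n))
decompositions {n} G m e =
  filter (λ P → isDecomposition? (V G) m P ×-dec All.all? (λ S → ¬? (e ∈ₑ? E (G ⟦ S ⟧))) P)
         (subsets (allSubsets n))

{-# OPTIONS --safe #-}
-- Deleting e from a set F in which e is a bridge flips the sign of F and gives,
-- bijectively, the edge sets F′ with i + 1 components that leave the endpoints of
-- e unconnected. Grouping these F′ by the partition of V into their components,
-- the group of V₁ ⊔ ⋯ ⊔ Vᵢ₊₁ consists of the disjoint unions of connected spanning
-- edge sets of the G[Vⱼ], so its signed sum is the product of the a₁(G[Vⱼ]).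
module Submission where

open import Defs
open import Data.Bool using (if_then_else_; true)
open import Data.Fin using (Fin)
open import Data.Nat as ℕ using (ℕ; suc; _≤_)
import Data.Nat.Properties as ℕ
open import Data.Integer as ℤ using (ℤ; 0ℤ; 1ℤ; -1ℤ; _+_; _*_; _^_; -_)
open import Data.Integer.Properties
  using (+-assoc; +-identityˡ; +-identityʳ; +-injective; *-identityˡ;
         *-zeroˡ; *-zeroʳ; *-distribˡ-+; ^-distribˡ-+-*; pos-+)
open import Data.Integer.Tactic.RingSolver using (solve-∀)
open import Data.Fin.Subset as Subset using (Subset; inside; outside; Nonempty; Empty; _∩_; ⋃)
open import Data.Fin.Subset.Properties
  using (_∈?_; ⊆-antisym; x∈p∩q⁺; x∈p∩q⁻; x∈p∪q⁻; x∈p∪q⁺; ∉⊥)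
open import Data.List using (List; []; _∷_; _++_; map; foldr; filter; length)
open import Data.List.Properties
  using (map-∘; filter-accept; filter-reject; filter-all; filter-none; filter-≐; ∷-injectiveʳ)
import Data.List.Properties as List
open import Data.List.Membership.Propositional using (_∈_; _∉_; find; lose)
open import Data.List.Membership.Propositional.Properties
  using (∈-filter⁺; ∈-filter⁻; ∈-map⁺; ∈-map⁻; ∈-++⁺ˡ; ∈-++⁺ʳ; ∈-++⁻)
open import Data.List.Relation.Binary.Sublist.Propositional using (_⊆_; []; _∷_; _∷ʳ_; lookup)
open import Data.List.Relation.Binary.Sublist.Propositional.Properties using (filter-⊆; All-resp-⊆)
open import Data.List.Relation.Unary.All as All using (All; []; _∷_; all?)
open import Data.List.Relation.Unary.All.Properties using (¬All⇒Any¬)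
open import Data.List.Relation.Unary.AllPairs using (AllPairs; []; _∷_)
open import Data.List.Relation.Unary.Any as Any using (Any; here; there; any?)
open import Data.List.Relation.Unary.Unique.Propositional using (Unique)
import Data.List.Relation.Unary.Unique.Propositional.Properties as Unique
open import Data.Product using (_×_; _,_; proj₁; proj₂)
open import Data.Sum using (_⊎_; inj₁; inj₂)
open import Data.Vec as Vec using ([]; _∷_)
open import Data.Vec.Properties as Vec using (lookup∘tabulate; []=⇒lookup; lookup⇒[]=)
open import Data.Bool.Properties using () renaming (_≟_ to _≟ᵇ_)
open import Function.Construct.Symmetry using (⇔-sym)
open import Function using (_∘_; _⇔_; mk⇔; Equivalence)
open import Relation.Binary.Construct.Closure.Equivalence using (symmetric; transitive)
open import Relation.Binary.Construct.Closure.ReflexiveTransitive using (ε; _◅_)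
open import Relation.Binary.Construct.Closure.Symmetric using (fwd; bwd)
open import Relation.Binary.Definitions using (DecidableEquality)
open import Relation.Binary.PropositionalEquality
  using (_≡_; _≢_; refl; sym; trans; cong; cong₂; subst; module ≡-Reasoning)
open import Relation.Nullary using (Dec; yes; no; does; ¬_; ¬?; contradiction)
open import Relation.Nullary.Decidable using (_×-dec_; dec-true; dec-false; does-⇔)
import Relation.Unary as U

open Equivalence using (to; from)
open ≡-Reasoning

-- No bijection between lists is built. A sum over a filtered list becomes a sum over the whole list
-- weighted by indicators `𝟙`, so the deletion of `e` and the grouping by components turn into
-- identities between sums over `subsets (E G)` and `subsets (allSubsets n)`. Two points need work.
-- A bridge is defined by a count of components, whereas a partition only shows whether the
-- endpoints of `e` lie together; the link is that deleting `e` leaves the count unchanged if its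
-- endpoints stay connected, and raises it by exactly one otherwise. For the grouping, the product
-- of the `a₁` over a decomposition `P` is expanded into one sum over all edge sets `F`, in which
-- only those `F` survive whose list of components is `P`; once the two sums are exchanged, each `F`
-- selects a single `P`. Plain equality of lists suffices to compare `P` with a list of components,
-- because both are sublists of the duplicate-free `allSubsets n`, where an unordered family has
-- only one listing.

private variable
  A B : Set
  P Q : A → Set
  n : ℕ

-- Finite sums and indicators

𝟙 : Dec A → ℤ
𝟙 a? = if does a? then 1ℤ else 0ℤ

𝟙-yes : (a? : Dec A) → A → 𝟙 a? ≡ 1ℤ
𝟙-yes a? a = cong (if_then 1ℤ else 0ℤ) (dec-true a? a)

𝟙-no : (a? : Dec A) → ¬ A → 𝟙 a? ≡ 0ℤ
𝟙-no a? ¬a = cong (if_then 1ℤ else 0ℤ) (dec-false a? ¬a)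

𝟙-⇔ : (a? : Dec A) (b? : Dec B) → A ⇔ B → 𝟙 a? ≡ 𝟙 b?
𝟙-⇔ a? b? A⇔B = cong (if_then 1ℤ else 0ℤ) (does-⇔ A⇔B a? b?)

𝟙-yes-* : (a? : Dec A) → A → ∀ z → 𝟙 a? * z ≡ z
𝟙-yes-* a? a z = trans (cong (_* z) (𝟙-yes a? a)) (*-identityˡ z)

𝟙-no-* : (a? : Dec A) → ¬ A → ∀ z → 𝟙 a? * z ≡ 0ℤ
𝟙-no-* a? ¬a z = trans (cong (_* z) (𝟙-no a? ¬a)) (*-zeroˡ z)

-- Where the indicator vanishes nothing has to be shown, so the condition tested by `a?` may be
-- assumed when its cofactor is rewritten.
𝟙-*-cong : (a? : Dec A) → ∀ {x y} → (A → x ≡ y) → 𝟙 a? * x ≡ 𝟙 a? * y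
𝟙-*-cong (yes a)         x≡y = cong (1ℤ *_) (x≡y a)
𝟙-*-cong (no _)  {x} {y} x≡y = trans (*-zeroˡ x) (sym (*-zeroˡ y))

∑-cong : ∀ (xs : List A) {f g} → (∀ {x} → x ∈ xs → f x ≡ g x) → ∑ xs f ≡ ∑ xs g
∑-cong []       eq = refl
∑-cong (x ∷ xs) eq = cong₂ _+_ (eq (here refl)) (∑-cong xs (eq ∘ there))

∑-zero : ∀ (xs : List A) {f} → (∀ {x} → x ∈ xs → f x ≡ 0ℤ) → ∑ xs f ≡ 0ℤ
∑-zero []       eq = refl
∑-zero (x ∷ xs) eq = cong₂ _+_ (eq (here refl)) (∑-zero xs (eq ∘ there))

∑-++ : ∀ (xs ys : List A) f → ∑ (xs ++ ys) f ≡ ∑ xs f + ∑ ys f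
∑-++ []       ys f = sym (+-identityˡ _)
∑-++ (x ∷ xs) ys f = trans (cong (f x +_) (∑-++ xs ys f)) (sym (+-assoc (f x) _ _))

∑-map : ∀ (h : A → B) xs f → ∑ (map h xs) f ≡ ∑ xs (f ∘ h)
∑-map h xs f = cong (foldr _+_ 0ℤ) (sym (map-∘ xs))

∑-+ : ∀ (xs : List A) f g → ∑ xs (λ x → f x + g x) ≡ ∑ xs f + ∑ xs g
∑-+ []       f g = refl
∑-+ (x ∷ xs) f g = trans (cong (f x + g x +_) (∑-+ xs f g)) (interchange (f x) (g x) (∑ xs f) (∑ xs g))
  where
  interchange : ∀ a b c d → (a + b) + (c + d) ≡ (a + c) + (b + d)
  interchange = solve-∀

∑-*ˡ : ∀ (xs : List A) c f → ∑ xs (λ x → c * f x) ≡ c * ∑ xs f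
∑-*ˡ []       c f = sym (*-zeroʳ c)
∑-*ˡ (x ∷ xs) c f = trans (cong (c * f x +_) (∑-*ˡ xs c f)) (sym (*-distribˡ-+ c _ _))

∑-swap : ∀ (xs : List A) (ys : List B) (f : A → B → ℤ) →
         ∑ xs (λ x → ∑ ys (f x)) ≡ ∑ ys (λ y → ∑ xs (λ x → f x y))
∑-swap []       ys f = sym (∑-zero ys (λ _ → refl))
∑-swap (x ∷ xs) ys f =
  trans (cong (∑ ys (f x) +_) (∑-swap xs ys f)) (sym (∑-+ ys (f x) _))

∑-filter : (P? : U.Decidable P) (xs : List A) (f : A → ℤ) →
           ∑ (filter P? xs) f ≡ ∑ xs (λ x → 𝟙 (P? x) * f x)
∑-filter P? []       f = refl
∑-filter P? (x ∷ xs) f with P? x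
... | yes _ = cong₂ _+_ (sym (*-identityˡ (f x))) (∑-filter P? xs f)
... | no _  = trans (sym (+-identityˡ _)) (cong₂ _+_ (sym (*-zeroˡ (f x))) (∑-filter P? xs f))

length-filter : (P? : U.Decidable P) (xs : List A) →
                ℤ.+ length (filter P? xs) ≡ ∑ xs (λ x → 𝟙 (P? x))
length-filter P? []       = refl
length-filter P? (x ∷ xs) with P? x
... | yes _ = trans (pos-+ 1 _) (cong (1ℤ +_) (length-filter P? xs))
... | no _  = trans (length-filter P? xs) (sym (+-identityˡ _))

-- Uniqueness keeps the one surviving term from being counted twice.
∑-pick : ∀ {xs : List A} {x f} → Unique xs → x ∈ xs →
         (∀ {y} → y ∈ xs → y ≢ x → f y ≡ 0ℤ) → ∑ xs f ≡ f x
∑-pick {xs = x ∷ xs} {f = f} (x∉ ∷ _) (here refl) f≡0 = trans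
  (cong (f x +_) (∑-zero xs λ y∈ → f≡0 (there y∈) (All.lookup x∉ y∈ ∘ sym)))
  (+-identityʳ (f x))
∑-pick (x∉ ∷ u) (there x∈) f≡0 = trans
  (cong₂ _+_ (f≡0 (here refl) (All.lookup x∉ x∈)) (∑-pick u x∈ (f≡0 ∘ there)))
  (+-identityˡ _)

∑-𝟙-≡ : (_≟_ : DecidableEquality A) {xs : List A} {x : A} → Unique xs → x ∈ xs →
        ∑ xs (λ y → 𝟙 (y ≟ x)) ≡ 1ℤ
∑-𝟙-≡ _≟_ {x = x} u x∈ =
  trans (∑-pick u x∈ (λ {y} _ → 𝟙-no (y ≟ x))) (𝟙-yes (x ≟ x) refl)

∏-cong : ∀ (xs : List A) {f g} → (∀ {x} → x ∈ xs → f x ≡ g x) → ∏ xs f ≡ ∏ xs g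
∏-cong []       eq = refl
∏-cong (x ∷ xs) eq = cong₂ _*_ (eq (here refl)) (∏-cong xs (eq ∘ there))

∏-zero : ∀ {xs : List A} {x f} → x ∈ xs → f x ≡ 0ℤ → ∏ xs f ≡ 0ℤ
∏-zero {xs = x ∷ xs} {f = f} (here refl) f≡0 = trans (cong (_* ∏ xs f) f≡0) (*-zeroˡ (∏ xs f))
∏-zero {f = f} (there x∈)  f≡0 = trans (cong (f _ *_) (∏-zero x∈ f≡0)) (*-zeroʳ (f _))

-- Sublists and subsets

∑-subsets-∷ : ∀ (x : A) xs f →
              ∑ (subsets (x ∷ xs)) f ≡ ∑ (subsets xs) (f ∘ (x ∷_)) + ∑ (subsets xs) f
∑-subsets-∷ x xs f = trans (∑-++ (map (x ∷_) (subsets xs)) _ f)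
                           (cong (_+ ∑ (subsets xs) f) (∑-map (x ∷_) (subsets xs) f))

∈-subsets⁻ : ∀ (xs : List A) {ys} → ys ∈ subsets xs → ys ⊆ xs
∈-subsets⁻ []       (here refl) = []
∈-subsets⁻ (x ∷ xs) ys∈ with ∈-++⁻ (map (x ∷_) (subsets xs)) ys∈
... | inj₂ ys∈′ = x ∷ʳ ∈-subsets⁻ xs ys∈′
... | inj₁ ys∈′ with ∈-map⁻ (x ∷_) ys∈′
...   | _ , zs∈ , refl = refl ∷ ∈-subsets⁻ xs zs∈

∈-subsets⁺ : ∀ {xs ys : List A} → ys ⊆ xs → ys ∈ subsets xs
∈-subsets⁺ []         = here refl
∈-subsets⁺ (x ∷ʳ τ)   = ∈-++⁺ʳ (map (x ∷_) _) (∈-subsets⁺ τ)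
∈-subsets⁺ (refl ∷ τ) = ∈-++⁺ˡ (∈-map⁺ (_ ∷_) (∈-subsets⁺ τ))

Unique-⊆ : ∀ {xs ys : List A} → ys ⊆ xs → Unique xs → Unique ys
Unique-⊆ []         []       = []
Unique-⊆ (x ∷ʳ τ)   (_ ∷ u)  = Unique-⊆ τ u
Unique-⊆ (refl ∷ τ) (x∉ ∷ u) = All-resp-⊆ τ x∉ ∷ Unique-⊆ τ u

Unique-subsets : ∀ {xs : List A} → Unique xs → Unique (subsets xs)
Unique-subsets []                 = [] ∷ []
Unique-subsets {xs = x ∷ xs} (x∉ ∷ u) =
  Unique.++⁺ (Unique.map⁺ ∷-injectiveʳ (Unique-subsets u)) (Unique-subsets u) disjoint
  where
  disjoint : ∀ {ys} → ¬ (ys ∈ map (x ∷_) (subsets xs) × ys ∈ subsets xs)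
  disjoint (ys∈ , ys∈′) with ∈-map⁻ (x ∷_) ys∈
  ... | _ , _ , refl = All.lookup x∉ (lookup (∈-subsets⁻ xs ys∈′) (here refl)) refl

-- A sublist inherits its order from `xs`, so in the absence of duplicates it is determined by its
-- members.
⊆-filter-≡ : ∀ {xs ys : List A} (P? : U.Decidable P) → Unique xs → ys ⊆ xs →
             (∀ {x} → x ∈ xs → x ∈ ys ⇔ P x) → filter P? xs ≡ ys
⊆-filter-≡ P? [] [] eq = refl
⊆-filter-≡ {ys = ys} P? (x∉ ∷ u) (x ∷ʳ τ) eq = trans
  (filter-reject P? λ px → All.lookup x∉ (lookup τ (from (eq (here refl)) px)) refl)
  (⊆-filter-≡ P? u τ (eq ∘ there))
⊆-filter-≡ {xs = x ∷ xs} P? (x∉ ∷ u) (refl ∷ τ) eq = trans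
  (filter-accept P? (to (eq (here refl)) (here refl)))
  (cong (x ∷_) (⊆-filter-≡ P? u τ λ y∈ → mk⇔
    (to (eq (there y∈)) ∘ there)
    (λ py → drop y∈ (from (eq (there y∈)) py))))
  where
  drop : ∀ {y ys} → y ∈ xs → y ∈ x ∷ ys → y ∈ ys
  drop y∈ (here refl) = contradiction refl (All.lookup x∉ y∈)
  drop y∈ (there y∈′) = y∈′

allSubsets-complete : (S : Subset n) → S ∈ allSubsets n
allSubsets-complete []            = here refl
allSubsets-complete (inside ∷ S)  = ∈-++⁺ˡ (∈-map⁺ (inside ∷_) (allSubsets-complete S))
allSubsets-complete (outside ∷ S) = ∈-++⁺ʳ _ (∈-map⁺ (outside ∷_) (allSubsets-complete S))

Unique-allSubsets : ∀ n → Unique (allSubsets n)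
Unique-allSubsets ℕ.zero  = [] ∷ []
Unique-allSubsets (suc n) =
  Unique.++⁺ (Unique.map⁺ Vec.∷-injectiveʳ u) (Unique.map⁺ Vec.∷-injectiveʳ u) disjoint
  where
  u = Unique-allSubsets n
  disjoint : ∀ {S} → ¬ (S ∈ map (inside ∷_) (allSubsets n) × S ∈ map (outside ∷_) (allSubsets n))
  disjoint (S∈ , S∈′) with ∈-map⁻ (inside ∷_) S∈
  ... | _ , _ , refl with ∈-map⁻ (outside ∷_) S∈′
  ...   | _ , _ , ()

-- Signs, and subsets of a list split into two disjoint kinds

sgn : List A → ℤ
sgn F = -1ℤ ^ length F

module _ {A B C : A → Set} {A? : U.Decidable A} {B? : U.Decidable B} {C? : U.Decidable C}
         (C⇔A⊎B : ∀ x → C x ⇔ (A x ⊎ B x)) (disjoint : ∀ {x} → A x → ¬ B x) where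

  sgn-filter-⊎ : ∀ xs → sgn (filter C? xs) ≡ sgn (filter A? xs) * sgn (filter B? xs)
  sgn-filter-⊎ xs = trans (cong (-1ℤ ^_) (length-filter-⊎ xs))
                          (^-distribˡ-+-* -1ℤ (length (filter A? xs)) _)
    where
    length-filter-⊎ : ∀ xs →
      length (filter C? xs) ≡ length (filter A? xs) ℕ.+ length (filter B? xs)
    length-filter-⊎ [] = refl
    length-filter-⊎ (x ∷ xs) with A? x | B? x | C? x
    ... | yes a | yes b | _     = contradiction b (disjoint a)
    ... | yes a | no _  | yes _ = cong suc (length-filter-⊎ xs)
    ... | no _  | yes _ | yes _ = trans (cong suc (length-filter-⊎ xs)) (sym (ℕ.+-suc _ _))
    ... | no _  | no _  | no _  = length-filter-⊎ xs
    ... | yes a | no _  | no ¬c = contradiction (from (C⇔A⊎B x) (inj₁ a)) ¬c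
    ... | no _  | yes b | no ¬c = contradiction (from (C⇔A⊎B x) (inj₂ b)) ¬c
    ... | no ¬a | no ¬b | yes c with to (C⇔A⊎B x) c
    ...   | inj₁ a = contradiction a ¬a
    ...   | inj₂ b = contradiction b ¬b

  -- A subset of the `C`-part is a pair of a subset of the `A`-part and a subset of the `B`-part.
  -- Each new element is seen by only one factor, whose sum splits by whether it is chosen; `g` and
  -- `h` are arbitrary so that the induction can absorb a chosen element into them.
  ∑-subsets-⊎ : ∀ xs (g h : List _ → ℤ) →
    ∑ (subsets (filter C? xs)) (λ F → g (filter A? F) * h (filter B? F)) ≡
    ∑ (subsets (filter A? xs)) g * ∑ (subsets (filter B? xs)) h
  ∑-subsets-⊎ [] g h = lemma (g []) (h [])
    where
    lemma : ∀ a b → a * b + 0ℤ ≡ (a + 0ℤ) * (b + 0ℤ)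
    lemma = solve-∀
  ∑-subsets-⊎ (x ∷ xs) g h with A? x in eqA | B? x in eqB | C? x
  ... | yes a | yes b | _     = contradiction b (disjoint a)
  ... | no _  | no _  | no _  = ∑-subsets-⊎ xs g h
  ... | yes a | no _  | no ¬c = contradiction (from (C⇔A⊎B x) (inj₁ a)) ¬c
  ... | no _  | yes b | no ¬c = contradiction (from (C⇔A⊎B x) (inj₂ b)) ¬c
  ... | no ¬a | no ¬b | yes c with to (C⇔A⊎B x) c
  ...   | inj₁ a = contradiction a ¬a
  ...   | inj₂ b = contradiction b ¬b
  ∑-subsets-⊎ (x ∷ xs) g h | yes a | no ¬b | yes _ = begin
    ∑ (subsets (x ∷ filter C? xs)) (λ F → g (filter A? F) * h (filter B? F))
      ≡⟨ ∑-subsets-∷ x (filter C? xs) _ ⟩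
    ∑ Fs (λ F → g (filter A? (x ∷ F)) * h (filter B? (x ∷ F))) + ∑ Fs (λ F → g (filter A? F) * h (filter B? F))
      ≡⟨ cong₂ _+_ (trans (∑-cong Fs λ _ → cong₂ _*_
                            (cong g (filter-accept A? a)) (cong h (filter-reject B? ¬b)))
                          (∑-subsets-⊎ xs (g ∘ (x ∷_)) h))
                   (∑-subsets-⊎ xs g h) ⟩
    G∷ * H + G * H
      ≡⟨ lemma G∷ G H ⟩
    (G∷ + G) * H
      ≡⟨ cong (_* H) (∑-subsets-∷ x (filter A? xs) g) ⟨
    ∑ (subsets (x ∷ filter A? xs)) g * H ∎
    where
    Fs = subsets (filter C? xs)
    G∷ = ∑ (subsets (filter A? xs)) (g ∘ (x ∷_))
    G  = ∑ (subsets (filter A? xs)) g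
    H  = ∑ (subsets (filter B? xs)) h
    lemma : ∀ a b c → a * c + b * c ≡ (a + b) * c
    lemma = solve-∀
  ∑-subsets-⊎ (x ∷ xs) g h | no ¬a | yes b | yes _ = begin
    ∑ (subsets (x ∷ filter C? xs)) (λ F → g (filter A? F) * h (filter B? F))
      ≡⟨ ∑-subsets-∷ x (filter C? xs) _ ⟩
    ∑ Fs (λ F → g (filter A? (x ∷ F)) * h (filter B? (x ∷ F))) + ∑ Fs (λ F → g (filter A? F) * h (filter B? F))
      ≡⟨ cong₂ _+_ (trans (∑-cong Fs λ _ → cong₂ _*_
                            (cong g (filter-reject A? ¬a)) (cong h (filter-accept B? b)))
                          (∑-subsets-⊎ xs g (h ∘ (x ∷_))))
                   (∑-subsets-⊎ xs g h) ⟩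
    G * H∷ + G * H
      ≡⟨ *-distribˡ-+ G H∷ H ⟨
    G * (H∷ + H)
      ≡⟨ cong (G *_) (∑-subsets-∷ x (filter B? xs) h) ⟨
    G * ∑ (subsets (x ∷ filter B? xs)) h ∎
    where
    Fs = subsets (filter C? xs)
    G  = ∑ (subsets (filter A? xs)) g
    H∷ = ∑ (subsets (filter B? xs)) (h ∘ (x ∷_))
    H  = ∑ (subsets (filter B? xs)) h

-- Deleting an edge

∖-∈⁻ : ∀ {F : List (Edge n)} {e f} → f ∈ F ∖ e → f ∈ F
∖-∈⁻ {e = e} = proj₁ ∘ ∈-filter⁻ (λ f → ¬? (f ≟ₑ e))

∈-∖ : ∀ {F : List (Edge n)} {e f} → f ∈ F → f ≢ e → f ∈ F ∖ e
∈-∖ {e = e} = ∈-filter⁺ (λ f → ¬? (f ≟ₑ e))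

∉-∖ : ∀ {F : List (Edge n)} {e} → e ∉ F → F ∖ e ≡ F
∉-∖ {F = F} {e} e∉ = filter-all _ (All.tabulate λ { f∈ refl → e∉ f∈ })

∖-here : ∀ (F : List (Edge n)) {e} → e ∉ F → (e ∷ F) ∖ e ≡ F
∖-here F {e} e∉ = trans (filter-reject (λ f → ¬? (f ≟ₑ e)) (λ e≢e → e≢e refl)) (∉-∖ e∉)

∖-there : ∀ {F : List (Edge n)} {e f} → f ≢ e → (f ∷ F) ∖ e ≡ f ∷ (F ∖ e)
∖-there {e = e} = filter-accept (λ f → ¬? (f ≟ₑ e))

-- Uniqueness makes the deletion remove one entry only, hence one factor `-1ℤ`.
sgn-∖ : ∀ {F : List (Edge n)} {e} → Unique F → e ∈ F → sgn F ≡ - sgn (F ∖ e)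
sgn-∖ {F = e ∷ F} (e∉ ∷ _) (here refl) = trans (lemma (sgn F))
  (cong (-_ ∘ sgn) (sym (∖-here F λ e∈ → All.lookup e∉ e∈ refl)))
  where
  lemma : ∀ z → -1ℤ * z ≡ - z
  lemma = solve-∀
sgn-∖ {F = f ∷ F} {e} (f∉ ∷ u) (there e∈) = begin
  -1ℤ * sgn F           ≡⟨ cong (-1ℤ *_) (sgn-∖ u e∈) ⟩
  -1ℤ * - sgn (F ∖ e)   ≡⟨ lemma (sgn (F ∖ e)) ⟩
  - (-1ℤ * sgn (F ∖ e)) ≡⟨ cong (-_ ∘ sgn) (∖-there {F = F} (All.lookup f∉ e∈)) ⟨
  - sgn ((f ∷ F) ∖ e)   ∎
  where
  lemma : ∀ z → -1ℤ * - z ≡ - (-1ℤ * z)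
  lemma = solve-∀

-- Deletion of `e` matches the subsets with `e`, where `φ` lives, to those without it, where `ψ`
-- lives. When `e` heads the list these are the two halves of `subsets`; an earlier edge `f` is
-- absorbed into `φ` and `ψ`, which are therefore arbitrary.
∑-subsets-∖ : ∀ {E : List (Edge n)} {e} (φ ψ : List (Edge n) → ℤ) → Unique E → e ∈ E →
  (∀ {F} → F ⊆ E → e ∉ F → φ F ≡ 0ℤ) →
  (∀ {F} → F ⊆ E → e ∈ F → ψ F ≡ 0ℤ) →
  (∀ {F} → F ⊆ E → e ∈ F → φ F ≡ - ψ (F ∖ e)) →
  ∑ (subsets E) φ ≡ - ∑ (subsets E) ψ
∑-subsets-∖ {E = e ∷ E} φ ψ (e∉ ∷ u) (here refl) φ≡0 ψ≡0 φ≡-ψ = begin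
  ∑ (subsets (e ∷ E)) φ
    ≡⟨ ∑-subsets-∷ e E φ ⟩
  ∑ (subsets E) (φ ∘ (e ∷_)) + ∑ (subsets E) φ
    ≡⟨ cong₂ _+_
         (∑-cong (subsets E) λ {F} F∈ → trans (φ≡-ψ (refl ∷ ∈-subsets⁻ E F∈) (here refl))
                                          (trans (cong (-_ ∘ ψ) (∖-here F (∉F F∈))) (neg (ψ F))))
         (∑-zero (subsets E) λ F∈ → φ≡0 (e ∷ʳ ∈-subsets⁻ E F∈) (∉F F∈)) ⟩
  ∑ (subsets E) (λ F → -1ℤ * ψ F) + 0ℤ
    ≡⟨ cong (_+ 0ℤ) (∑-*ˡ (subsets E) -1ℤ ψ) ⟩
  -1ℤ * ∑ (subsets E) ψ + 0ℤ
    ≡⟨ lemma (∑ (subsets E) ψ) ⟩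
  - (0ℤ + ∑ (subsets E) ψ)
    ≡⟨ cong (λ z → - (z + ∑ (subsets E) ψ))
         (∑-zero (subsets E) λ F∈ → ψ≡0 (refl ∷ ∈-subsets⁻ E F∈) (here refl)) ⟨
  - (∑ (subsets E) (ψ ∘ (e ∷_)) + ∑ (subsets E) ψ)
    ≡⟨ cong -_ (∑-subsets-∷ e E ψ) ⟨
  - ∑ (subsets (e ∷ E)) ψ ∎
  where
  ∉F : ∀ {F} → F ∈ subsets E → e ∉ F
  ∉F F∈ e∈ = All.lookup e∉ (lookup (∈-subsets⁻ E F∈) e∈) refl
  neg : ∀ z → - z ≡ -1ℤ * z
  neg = solve-∀
  lemma : ∀ z → -1ℤ * z + 0ℤ ≡ - (0ℤ + z)
  lemma = solve-∀
∑-subsets-∖ {E = f ∷ E} {e} φ ψ (f∉ ∷ u) (there e∈) φ≡0 ψ≡0 φ≡-ψ = begin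
  ∑ (subsets (f ∷ E)) φ
    ≡⟨ ∑-subsets-∷ f E φ ⟩
  ∑ (subsets E) (φ ∘ (f ∷_)) + ∑ (subsets E) φ
    ≡⟨ cong₂ _+_
         (∑-subsets-∖ (φ ∘ (f ∷_)) (ψ ∘ (f ∷_)) u e∈
            (λ τ e∉ → φ≡0 (refl ∷ τ) λ { (here refl) → f≢e refl ; (there e∈F) → e∉ e∈F })
            (λ τ e∈F → ψ≡0 (refl ∷ τ) (there e∈F))
            (λ {F} τ e∈F → trans (φ≡-ψ (refl ∷ τ) (there e∈F)) (cong (-_ ∘ ψ) (∖-there {F = F} f≢e))))
         (∑-subsets-∖ φ ψ u e∈ (φ≡0 ∘ (f ∷ʳ_)) (ψ≡0 ∘ (f ∷ʳ_)) (φ≡-ψ ∘ (f ∷ʳ_))) ⟩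
  - ∑ (subsets E) (ψ ∘ (f ∷_)) + - ∑ (subsets E) ψ
    ≡⟨ lemma (∑ (subsets E) (ψ ∘ (f ∷_))) (∑ (subsets E) ψ) ⟩
  - (∑ (subsets E) (ψ ∘ (f ∷_)) + ∑ (subsets E) ψ)
    ≡⟨ cong -_ (∑-subsets-∷ f E ψ) ⟨
  - ∑ (subsets (f ∷ E)) ψ ∎
  where
  f≢e = All.lookup f∉ e∈
  lemma : ∀ a b → - a + - b ≡ - (a + b)
  lemma = solve-∀

-- Connectivity and components

private variable
  W S T       : Subset n
  F F′        : List (Edge n)
  u v x y     : Fin n

infixr 5 _⨾_

_⨾_ : Connected F u v → Connected F v x → Connected F u x
_⨾_ = transitive _

conn-sym : Connected F u v → Connected F v u
conn-sym = symmetric _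

edge⇒conn : (u , v) ∈ F → Connected F u v
edge⇒conn e∈ = fwd e∈ ◅ ε

-- Induction along a walk; `step` is an equivalence because a walk may traverse an edge backwards.
conn-preserves : (Q : Fin n → Set) → (∀ {a b} → (a , b) ∈ F → Q a ⇔ Q b) →
                 Connected F x y → Q x → Q y
conn-preserves Q step ε            q = q
conn-preserves Q step (fwd e∈ ◅ r) q = conn-preserves Q step r (to (step e∈) q)
conn-preserves Q step (bwd e∈ ◅ r) q = conn-preserves Q step r (from (step e∈) q)

conn-bind : (∀ {a b} → (a , b) ∈ F → Connected F′ a b) → Connected F x y → Connected F′ x y
conn-bind {F′ = F′} {x = x} h c = conn-preserves (Connected F′ x)
  (λ e∈ → mk⇔ (_⨾ h e∈) (_⨾ conn-sym (h e∈))) c ε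

conn-∖⇒conn : ∀ {e} → Connected (F ∖ e) x y → Connected F x y
conn-∖⇒conn {F = F} {e = e} = conn-bind (edge⇒conn ∘ ∖-∈⁻ {F = F} {e})

-- Each passage of a walk through `e` is rerouted along the given connection of its endpoints.
conn⇒conn-∖ : ∀ {e} → Connected (F ∖ e) (proj₁ e) (proj₂ e) → Connected F x y → Connected (F ∖ e) x y
conn⇒conn-∖ {F = F} {e = e} uv = conn-bind step
  where
  step : ∀ {a b} → (a , b) ∈ F → Connected (F ∖ e) a b
  step {a} {b} ab∈ with (a , b) ≟ₑ e
  ... | yes refl = uv
  ... | no ab≢e  = edge⇒conn (∈-∖ ab∈ ab≢e)

-- A walk must reach an endpoint of `e` without `e` before it can use `e`. As an invariant:
-- reachability from `x` in `F ∖ e`, which fails at both ends of `e`.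
avoiding⇒conn-∖ : ∀ {e} → ¬ Connected (F ∖ e) x (proj₁ e) → ¬ Connected (F ∖ e) x (proj₂ e) →
                  Connected F x y → Connected (F ∖ e) x y
avoiding⇒conn-∖ {F = F} {x = x} {e = e} ¬xu ¬xv c = conn-preserves (Connected (F ∖ e) x) step c ε
  where
  step : ∀ {a b} → (a , b) ∈ F → Connected (F ∖ e) x a ⇔ Connected (F ∖ e) x b
  step {a} {b} ab∈ with (a , b) ≟ₑ e
  ... | yes refl = mk⇔ (λ xu → contradiction xu ¬xu) (λ xv → contradiction xv ¬xv)
  ... | no ab≢e  = mk⇔ (_⨾ edge⇒conn ab∈′) (_⨾ conn-sym (edge⇒conn ab∈′))
    where ab∈′ = ∈-∖ ab∈ ab≢e

-- Components as vertex subsets, and their number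

_≟ˢ_ : DecidableEquality (Subset n)
_≟ˢ_ = Vec.≡-dec _≟ᵇ_

component : Subset n → List (Edge n) → Fin n → Subset n
component W F x = Vec.tabulate λ y → does ((y ∈? W) ×-dec connected? F x y)

∈-component : (F : List (Edge n)) → y Subset.∈ component W F x ⇔ (y Subset.∈ W × Connected F x y)
∈-component {y = y} {W} {x} F = mk⇔
  (λ y∈ → does-true y? (trans (sym (lookup∘tabulate _ y)) ([]=⇒lookup y∈)))
  (λ p → lookup⇒[]= y _ (trans (lookup∘tabulate _ y) (dec-true y? p)))
  where
  y? = (y ∈? W) ×-dec connected? F x y
  does-true : (a? : Dec A) → does a? ≡ true → A
  does-true (yes a) _ = a

isComponent-component : (F : List (Edge n)) → x Subset.∈ W → IsComponent W F (component W F x)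
isComponent-component {x = x} F x∈W = x , x∈W , λ _ → ∈-component F

x∈component : (F : List (Edge n)) → x Subset.∈ W → x Subset.∈ component W F x
x∈component F x∈W = from (∈-component F) (x∈W , ε)

-- `IsComponent` supplies some root; by symmetry and transitivity any vertex of `S` serves as well.
isComponent-∋ : IsComponent W F S → x Subset.∈ S →
                ∀ y → y Subset.∈ S ⇔ (y Subset.∈ W × Connected F x y)
isComponent-∋ (r , _ , ∈S) x∈S y = mk⇔
  (λ y∈S → let y∈W , ry = to (∈S y) y∈S in y∈W , conn-sym (proj₂ (to (∈S _) x∈S)) ⨾ ry)
  (λ (y∈W , xy) → from (∈S y) (y∈W , proj₂ (to (∈S _) x∈S) ⨾ xy))

isComponent-nonempty : IsComponent W F S → Nonempty S
isComponent-nonempty (r , r∈W , ∈S) = r , from (∈S r) (r∈W , ε)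

isComponent-⊆ : IsComponent W F S → x Subset.∈ S → x Subset.∈ W
isComponent-⊆ (_ , _ , ∈S) x∈S = proj₁ (to (∈S _) x∈S)

isComponent-unique : IsComponent W F S → IsComponent W F T →
                     x Subset.∈ S → x Subset.∈ T → S ≡ T
isComponent-unique CS CT x∈S x∈T = ⊆-antisym
  (λ y∈S → from (isComponent-∋ CT x∈T _) (to (isComponent-∋ CS x∈S _) y∈S))
  (λ y∈T → from (isComponent-∋ CS x∈S _) (to (isComponent-∋ CT x∈T _) y∈T))

-- Connectivity is compared only from vertices of `S`, so the edge sets may differ elsewhere, as
-- they do when `e` is deleted far from `S`.
isComponent-resp : (∀ {x y} → x Subset.∈ S → Connected F x y ⇔ Connected F′ x y) →
                   IsComponent W F S → IsComponent W F′ S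
isComponent-resp eq CS@(r , r∈W , ∈S) = r , r∈W , λ y → mk⇔
  (λ y∈S → let y∈W , ry = to (∈S y) y∈S in y∈W , to (eq r∈S) ry)
  (λ (y∈W , ry) → from (∈S y) (y∈W , from (eq r∈S) ry))
  where r∈S = from (∈S r) (r∈W , ε)

k-∑ : (W : Subset n) (F : List (Edge n)) →
      ℤ.+ k W F ≡ ∑ (allSubsets n) (λ S → 𝟙 (isComponent? W F S))
k-∑ W F = length-filter (isComponent? W F) (allSubsets _)

∑-allSubsets-≡ : (T : Subset n) → ∑ (allSubsets n) (λ S → 𝟙 (S ≟ˢ T)) ≡ 1ℤ
∑-allSubsets-≡ T = ∑-𝟙-≡ _≟ˢ_ (Unique-allSubsets _) (allSubsets-complete T)

k≡1⁺ : (∀ S → IsComponent W F S ⇔ (S ≡ T)) → k W F ≡ 1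
k≡1⁺ {n} {W} {F} {T} eq = +-injective (begin
  ℤ.+ k W F
    ≡⟨ k-∑ W F ⟩
  ∑ (allSubsets n) (λ S → 𝟙 (isComponent? W F S))
    ≡⟨ ∑-cong (allSubsets n) (λ {S} _ → 𝟙-⇔ (isComponent? W F S) (S ≟ˢ T) (eq S)) ⟩
  ∑ (allSubsets n) (λ S → 𝟙 (S ≟ˢ T))
    ≡⟨ ∑-allSubsets-≡ T ⟩
  1ℤ ∎)

-- The components of `x` and `y` both belong to a list of length one.
k≡1⁻ : k W F ≡ 1 → x Subset.∈ W → y Subset.∈ W → Connected F x y
k≡1⁻ {n} {W} {F} {x} {y} k≡1 x∈W y∈W = proj₂ (to (∈-component F)
  (subst (y Subset.∈_) (singleton k≡1 (∈comps y∈W) (∈comps x∈W)) (x∈component F y∈W)))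
  where
  ∈comps : ∀ {z} → z Subset.∈ W →
           component W F z ∈ filter (isComponent? W F) (allSubsets n)
  ∈comps z∈W = ∈-filter⁺ (isComponent? W F) (allSubsets-complete _) (isComponent-component F z∈W)
  singleton : ∀ {xs : List A} {a b} → length xs ≡ 1 → a ∈ xs → b ∈ xs → a ≡ b
  singleton {xs = _ ∷ []} _ (here refl) (here refl) = refl

-- Rerouting around `e` makes connectivity in `F` and `F ∖ e` agree, so the two lists of components
-- are equal.
k-∖-connected : ∀ {e} (W : Subset n) → Connected (F ∖ e) (proj₁ e) (proj₂ e) → k W (F ∖ e) ≡ k W F
k-∖-connected {n} {F} {e} W uv = cong length (filter-≐ (isComponent? W (F ∖ e)) (isComponent? W F)
  ( isComponent-resp (λ _ → mk⇔ conn-∖⇒conn (conn⇒conn-∖ uv))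
  , isComponent-resp (λ _ → mk⇔ (conn⇒conn-∖ uv) conn-∖⇒conn))
  (allSubsets n))

-- Deleting a bridge e replaces one component, that of e, by the two components
-- of its endpoints.
k-∖-disconnected : ∀ {e} → e ∈ F → proj₁ e Subset.∈ W → proj₂ e Subset.∈ W →
  ¬ Connected (F ∖ e) (proj₁ e) (proj₂ e) → k W (F ∖ e) ≡ suc (k W F)
k-∖-disconnected {n} {F} {W} {e@(u , v)} e∈ u∈W v∈W ¬uv = +-injective (begin
  ℤ.+ k W F⁻
    ≡⟨ k-∑ W F⁻ ⟩
  ∑ all (λ S → 𝟙 (isComponent? W F⁻ S))
    -- The indicator of `C` sums to 1. It is added and cancelled so that the comparison holds for
    -- each `S` separately, without subtraction.
    ≡⟨ move (∑ all (λ S → 𝟙 (isComponent? W F⁻ S))) ⟩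
  (∑ all (λ S → 𝟙 (isComponent? W F⁻ S)) + 1ℤ) + -1ℤ
    ≡⟨ cong (λ z → (∑ all (λ S → 𝟙 (isComponent? W F⁻ S)) + z) + -1ℤ) (∑-allSubsets-≡ C) ⟨
  (∑ all (λ S → 𝟙 (isComponent? W F⁻ S)) + ∑ all (λ S → 𝟙 (S ≟ˢ C))) + -1ℤ
    ≡⟨ cong (_+ -1ℤ) (∑-+ all _ _) ⟨
  ∑ all (λ S → 𝟙 (isComponent? W F⁻ S) + 𝟙 (S ≟ˢ C)) + -1ℤ
    ≡⟨ cong (_+ -1ℤ) (∑-cong all λ {S} _ → pointwise S) ⟩
  ∑ all (λ S → 𝟙 (isComponent? W F S) + (𝟙 (S ≟ˢ Cᵤ) + 𝟙 (S ≟ˢ Cᵥ))) + -1ℤ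
    ≡⟨ cong (_+ -1ℤ) (trans (∑-+ all _ _) (cong (∑ all (λ S → 𝟙 (isComponent? W F S)) +_)
         (trans (∑-+ all _ _) (cong₂ _+_ (∑-allSubsets-≡ Cᵤ) (∑-allSubsets-≡ Cᵥ))))) ⟩
  (∑ all (λ S → 𝟙 (isComponent? W F S)) + (1ℤ + 1ℤ)) + -1ℤ
    ≡⟨ cong (λ z → (z + (1ℤ + 1ℤ)) + -1ℤ) (k-∑ W F) ⟨
  (ℤ.+ k W F + (1ℤ + 1ℤ)) + -1ℤ
    ≡⟨ move′ (ℤ.+ k W F) ⟩
  1ℤ + ℤ.+ k W F
    ≡⟨ pos-+ 1 (k W F) ⟨
  ℤ.+ suc (k W F) ∎)
  where
  F⁻  = F ∖ e
  all = allSubsets n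
  C   = component W F u
  Cᵤ  = component W F⁻ u
  Cᵥ  = component W F⁻ v

  move : ∀ z → z ≡ (z + 1ℤ) + -1ℤ
  move = solve-∀
  move′ : ∀ z → (z + (1ℤ + 1ℤ)) + -1ℤ ≡ 1ℤ + z
  move′ = solve-∀

  u∈C : u Subset.∈ C
  u∈C = x∈component F u∈W
  v∈C : v Subset.∈ C
  v∈C = from (∈-component F) (v∈W , edge⇒conn e∈)
  u∈Cᵤ : u Subset.∈ Cᵤ
  u∈Cᵤ = x∈component F⁻ u∈W
  v∈Cᵥ : v Subset.∈ Cᵥ
  v∈Cᵥ = x∈component F⁻ v∈W
  v∉Cᵤ : ¬ v Subset.∈ Cᵤ
  v∉Cᵤ = ¬uv ∘ proj₂ ∘ to (∈-component F⁻)
  u∉Cᵥ : ¬ u Subset.∈ Cᵥ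
  u∉Cᵥ = ¬uv ∘ conn-sym ∘ proj₂ ∘ to (∈-component F⁻)

  Cᵤ≢C : Cᵤ ≢ C
  Cᵤ≢C eq = v∉Cᵤ (subst (v Subset.∈_) (sym eq) v∈C)
  Cᵥ≢C : Cᵥ ≢ C
  Cᵥ≢C eq = u∉Cᵥ (subst (u Subset.∈_) (sym eq) u∈C)
  Cᵤ≢Cᵥ : Cᵤ ≢ Cᵥ
  Cᵤ≢Cᵥ eq = v∉Cᵤ (subst (v Subset.∈_) (sym eq) v∈Cᵥ)

  isC : IsComponent W F C
  isC = isComponent-component F u∈W
  isCᵤ : IsComponent W F⁻ Cᵤ
  isCᵤ = isComponent-component F⁻ u∈W
  isCᵥ : IsComponent W F⁻ Cᵥ
  isCᵥ = isComponent-component F⁻ v∈W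

  conn⇔ : ¬ Connected F⁻ x u → ¬ Connected F⁻ x v → Connected F⁻ x y ⇔ Connected F x y
  conn⇔ ¬xu ¬xv = mk⇔ conn-∖⇒conn (avoiding⇒conn-∖ ¬xu ¬xv)

  -- Such a component contains neither endpoint of `e`, since it would otherwise be `Cᵤ`, `Cᵥ` or
  -- `C`; hence `e` does not affect connectivity from its vertices.
  other : ∀ S → S ≢ C → S ≢ Cᵤ → S ≢ Cᵥ → IsComponent W F⁻ S ⇔ IsComponent W F S
  other S S≢C S≢Cᵤ S≢Cᵥ = mk⇔
    (λ CS → isComponent-resp (λ x∈S → conn⇔
      (λ xu → S≢Cᵤ (isComponent-unique CS isCᵤ (from (isComponent-∋ CS x∈S u) (u∈W , xu)) u∈Cᵤ))
      (λ xv → S≢Cᵥ (isComponent-unique CS isCᵥ (from (isComponent-∋ CS x∈S v) (v∈W , xv)) v∈Cᵥ)))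
      CS)
    (λ CS → isComponent-resp (λ x∈S → ⇔-sym (conn⇔
      (λ xu → S≢C (isComponent-unique CS isC (from (isComponent-∋ CS x∈S u) (u∈W , conn-∖⇒conn xu)) u∈C))
      (λ xv → S≢C (isComponent-unique CS isC (from (isComponent-∋ CS x∈S v) (v∈W , conn-∖⇒conn xv)) v∈C))))
      CS)

  values : ∀ {a b a′ b′ c d} → a ≡ a′ → b ≡ b′ → a′ + c ≡ b′ + d → a + c ≡ b + d
  values refl refl eq = eq

  pointwise : ∀ S → 𝟙 (isComponent? W F⁻ S) + 𝟙 (S ≟ˢ C) ≡
                    𝟙 (isComponent? W F S) + (𝟙 (S ≟ˢ Cᵤ) + 𝟙 (S ≟ˢ Cᵥ))
  pointwise S with S ≟ˢ C | S ≟ˢ Cᵤ | S ≟ˢ Cᵥ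
  ... | yes S≡C | yes S≡Cᵤ | _        = contradiction (trans (sym S≡Cᵤ) S≡C) Cᵤ≢C
  ... | yes S≡C | no _     | yes S≡Cᵥ = contradiction (trans (sym S≡Cᵥ) S≡C) Cᵥ≢C
  ... | no _    | yes S≡Cᵤ | yes S≡Cᵥ = contradiction (trans (sym S≡Cᵤ) S≡Cᵥ) Cᵤ≢Cᵥ
  ... | yes S≡C | no S≢Cᵤ  | no _     = values
    (𝟙-no (isComponent? W F⁻ S) λ CS →
      S≢Cᵤ (isComponent-unique CS isCᵤ (subst (u Subset.∈_) (sym S≡C) u∈C) u∈Cᵤ))
    (𝟙-yes (isComponent? W F S) (subst (IsComponent W F) (sym S≡C) isC)) refl
  ... | no S≢C | yes S≡Cᵤ | no _     = values
    (𝟙-yes (isComponent? W F⁻ S) (subst (IsComponent W F⁻) (sym S≡Cᵤ) isCᵤ))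
    (𝟙-no (isComponent? W F S) λ CS →
      S≢C (isComponent-unique CS isC (subst (u Subset.∈_) (sym S≡Cᵤ) u∈Cᵤ) u∈C)) refl
  ... | no S≢C | no _     | yes S≡Cᵥ = values
    (𝟙-yes (isComponent? W F⁻ S) (subst (IsComponent W F⁻) (sym S≡Cᵥ) isCᵥ))
    (𝟙-no (isComponent? W F S) λ CS →
      S≢C (isComponent-unique CS isC (subst (v Subset.∈_) (sym S≡Cᵥ) v∈Cᵥ) v∈C)) refl
  ... | no S≢C | no S≢Cᵤ  | no S≢Cᵥ  = cong (_+ 0ℤ)
    (𝟙-⇔ (isComponent? W F⁻ S) (isComponent? W F S) (other S S≢C S≢Cᵤ S≢Cᵥ))

-- Edge sets split along the blocks of a decomposition

InBlock : List (Subset n) → Edge n → Set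
InBlock P e = Any (e ⊆ᵉ_) P

inBlock? : (P : List (Subset n)) → U.Decidable (InBlock P)
inBlock? P e = any? (e ⊆ᵉ?_) P

Disjoint : List (Subset n) → Set
Disjoint = AllPairs (λ S T → Empty (S ∩ T))

_⇂_ : List (Edge n) → Subset n → List (Edge n)
F ⇂ S = filter (_⊆ᵉ? S) F

filter-filter : (P? : U.Decidable P) (Q? : U.Decidable Q) → (∀ {x} → P x → Q x) →
                ∀ (xs : List A) → filter P? (filter Q? xs) ≡ filter P? xs
filter-filter P? Q? P⇒Q [] = refl
filter-filter P? Q? P⇒Q (x ∷ xs) with Q? x
... | no ¬q = trans (filter-filter P? Q? P⇒Q xs) (sym (filter-reject P? (¬q ∘ P⇒Q)))
... | yes _ with P? x
...   | yes _ = cong (x ∷_) (filter-filter P? Q? P⇒Q xs)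
...   | no _  = filter-filter P? Q? P⇒Q xs

-- Extension by zero: it replaces an index set that depends on the blocks by the fixed `subsets xs`,
-- so that sums can later be exchanged.
∑-subsets-filter : (Q? : U.Decidable Q) (xs : List A) (f : List A → ℤ) →
  ∑ (subsets (filter Q? xs)) f ≡ ∑ (subsets xs) (λ F → 𝟙 (all? Q? F) * f F)
∑-subsets-filter Q? [] f = cong (_+ 0ℤ) (sym (*-identityˡ (f [])))
∑-subsets-filter {Q = Q} Q? (x ∷ xs) f with Q? x
... | yes q = begin
  ∑ (subsets (x ∷ filter Q? xs)) f
    ≡⟨ ∑-subsets-∷ x (filter Q? xs) f ⟩
  ∑ (subsets (filter Q? xs)) (f ∘ (x ∷_)) + ∑ (subsets (filter Q? xs)) f
    ≡⟨ cong₂ _+_ (∑-subsets-filter Q? xs (f ∘ (x ∷_))) (∑-subsets-filter Q? xs f) ⟩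
  ∑ (subsets xs) (λ F → 𝟙 (all? Q? F) * f (x ∷ F)) + ∑ (subsets xs) (λ F → 𝟙 (all? Q? F) * f F)
    ≡⟨ cong (_+ _) (∑-cong (subsets xs) λ {F} _ → cong (_* f (x ∷ F))
         (𝟙-⇔ (all? Q? F) (all? Q? (x ∷ F)) (mk⇔ (q ∷_) All.tail))) ⟩
  ∑ (subsets xs) (λ F → 𝟙 (all? Q? (x ∷ F)) * f (x ∷ F)) + ∑ (subsets xs) (λ F → 𝟙 (all? Q? F) * f F)
    ≡⟨ ∑-subsets-∷ x xs (λ F → 𝟙 (all? Q? F) * f F) ⟨
  ∑ (subsets (x ∷ xs)) (λ F → 𝟙 (all? Q? F) * f F) ∎
... | no ¬q = begin
  ∑ (subsets (filter Q? xs)) f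
    ≡⟨ ∑-subsets-filter Q? xs f ⟩
  ∑ (subsets xs) (λ F → 𝟙 (all? Q? F) * f F)
    ≡⟨ +-identityˡ _ ⟨
  0ℤ + ∑ (subsets xs) (λ F → 𝟙 (all? Q? F) * f F)
    ≡⟨ cong (_+ _) (∑-zero (subsets xs) λ {F} _ →
         𝟙-no-* (all? Q? (x ∷ F)) (¬q ∘ All.head) (f (x ∷ F))) ⟨
  ∑ (subsets xs) (λ F → 𝟙 (all? Q? (x ∷ F)) * f (x ∷ F)) + ∑ (subsets xs) (λ F → 𝟙 (all? Q? F) * f F)
    ≡⟨ ∑-subsets-∷ x xs (λ F → 𝟙 (all? Q? F) * f F) ⟨
  ∑ (subsets (x ∷ xs)) (λ F → 𝟙 (all? Q? F) * f F) ∎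

inBlock-∷ : ∀ {P : List (Subset n)} e → InBlock (S ∷ P) e ⇔ (e ⊆ᵉ S ⊎ InBlock P e)
inBlock-∷ e = mk⇔ Any.toSum Any.fromSum

inBlock-disjoint : ∀ {P : List (Subset n)} → All (λ T → Empty (S ∩ T)) P →
                   ∀ {e} → e ⊆ᵉ S → ¬ InBlock P e
inBlock-disjoint S∩P e⊆S e∈P with find e∈P
... | T , T∈P , e⊆T = All.lookup S∩P T∈P (_ , x∈p∩q⁺ (proj₁ e⊆S , proj₁ e⊆T))

-- Independent choices of edges inside each block amount to one choice among the edges lying in some
-- block; disjointness puts every such edge in a single block.
∏-∑-subsets : ∀ {P : List (Subset n)} → Disjoint P → ∀ (g : Subset n → List (Edge n) → ℤ) E →
  ∏ P (λ S → ∑ (subsets (E ⇂ S)) (g S)) ≡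
  ∑ (subsets (filter (inBlock? P) E)) (λ F → ∏ P (λ S → g S (F ⇂ S)))
∏-∑-subsets [] g E = cong (λ E′ → ∑ (subsets E′) (λ _ → 1ℤ))
  (sym (filter-none (inBlock? []) (All.universal (λ _ ()) E)))
∏-∑-subsets {P = S ∷ P} (S∩P ∷ disjoint) g E = begin
  ∑ (subsets (E ⇂ S)) (g S) * ∏ P (λ T → ∑ (subsets (E ⇂ T)) (g T))
    ≡⟨ cong (∑ (subsets (E ⇂ S)) (g S) *_) (∏-∑-subsets disjoint g E) ⟩
  ∑ (subsets (E ⇂ S)) (g S) * ∑ (subsets (filter (inBlock? P) E)) h
    ≡⟨ ∑-subsets-⊎ {A? = _⊆ᵉ? S} {inBlock? P} {inBlock? (S ∷ P)}
         inBlock-∷ (inBlock-disjoint S∩P) E (g S) h ⟨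
  ∑ (subsets (filter (inBlock? (S ∷ P)) E)) (λ F → g S (F ⇂ S) * h (filter (inBlock? P) F))
    -- Edges inside a block `T` of `P` survive the filter for `P`, so restricting to `T` afterwards
    -- loses nothing.
    ≡⟨ ∑-cong (subsets (filter (inBlock? (S ∷ P)) E)) (λ {F} _ → cong (g S (F ⇂ S) *_)
         (∏-cong P λ {T} T∈P → cong (g T) (filter-filter (_⊆ᵉ? T) (inBlock? P) (lose T∈P) F))) ⟩
  ∑ (subsets (filter (inBlock? (S ∷ P)) E)) (λ F → g S (F ⇂ S) * h F) ∎
  where
  h : List (Edge _) → ℤ
  h F = ∏ P (λ T → g T (F ⇂ T))

∏-sgn : ∀ {P : List (Subset n)} → Disjoint P → ∀ F →
        ∏ P (λ S → sgn (F ⇂ S)) ≡ sgn (filter (inBlock? P) F)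
∏-sgn [] F = cong sgn (sym (filter-none (inBlock? []) (All.universal (λ _ ()) F)))
∏-sgn {P = S ∷ P} (S∩P ∷ disjoint) F = trans
  (cong (sgn (F ⇂ S) *_) (∏-sgn disjoint F))
  (sym (sgn-filter-⊎ {A? = _⊆ᵉ? S} {inBlock? P} {inBlock? (S ∷ P)} inBlock-∷ (inBlock-disjoint S∩P) F))

∈-⋃ : ∀ (P : List (Subset n)) → x Subset.∈ ⋃ P ⇔ Any (x Subset.∈_) P
∈-⋃ []      = mk⇔ (λ x∈ → contradiction x∈ ∉⊥) (λ ())
∈-⋃ (S ∷ P) = mk⇔ ⇒ ⇐
  where
  ⇒ : x Subset.∈ ⋃ (S ∷ P) → Any (x Subset.∈_) (S ∷ P)
  ⇒ x∈ with x∈p∪q⁻ S (⋃ P) x∈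
  ... | inj₁ x∈S = here x∈S
  ... | inj₂ x∈P = there (to (∈-⋃ P) x∈P)
  ⇐ : Any (x Subset.∈_) (S ∷ P) → x Subset.∈ ⋃ (S ∷ P)
  ⇐ (here x∈S)  = x∈p∪q⁺ (inj₁ x∈S)
  ⇐ (there x∈P) = x∈p∪q⁺ (inj₂ (from (∈-⋃ P) x∈P))

disjoint⇒≡ : ∀ {P : List (Subset n)} → Disjoint P → S ∈ P → T ∈ P →
             x Subset.∈ S → x Subset.∈ T → S ≡ T
disjoint⇒≡ _           (here refl) (here refl) _   _   = refl
disjoint⇒≡ (S∩P ∷ _)   (here refl) (there T∈)  x∈S x∈T =
  contradiction (_ , x∈p∩q⁺ (x∈S , x∈T)) (All.lookup S∩P T∈)
disjoint⇒≡ (T∩P ∷ _)   (there S∈)  (here refl) x∈S x∈T =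
  contradiction (_ , x∈p∩q⁺ (x∈T , x∈S)) (All.lookup T∩P S∈)
disjoint⇒≡ (_ ∷ disj)  (there S∈)  (there T∈)  x∈S x∈T = disjoint⇒≡ disj S∈ T∈ x∈S x∈T

-- As a filter of `allSubsets`, this is the very list by which `decompositions` represents the
-- partition into components.
components : Subset n → List (Edge n) → List (Subset n)
components W F = filter (isComponent? W F) (allSubsets _)

∈-components : (F : List (Edge n)) → S ∈ components W F ⇔ IsComponent W F S
∈-components {W = W} F = mk⇔ (proj₂ ∘ ∈-filter⁻ (isComponent? W F) {xs = allSubsets _})
                             (∈-filter⁺ (isComponent? W F) (allSubsets-complete _))

components-decomposition : (W : Subset n) (F : List (Edge n)) →
                           IsDecomposition W (k W F) (components W F)
components-decomposition {n} W F = record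
  { size     = refl
  ; nonempty = All.map isComponent-nonempty all
  ; disjoint = disjoint (Unique.filter⁺ (isComponent? W F) (Unique-allSubsets n)) all
  ; cover    = ⊆-antisym
      (λ x∈ → let S , S∈ , x∈S = find (to (∈-⋃ (components W F)) x∈)
              in isComponent-⊆ (All.lookup all S∈) x∈S)
      (λ x∈W → from (∈-⋃ (components W F))
        (lose (from (∈-components F) (isComponent-component F x∈W)) (x∈component F x∈W)))
  }
  where
  all : All (IsComponent W F) (components W F)
  all = All.tabulate (to (∈-components F))
  disjoint : ∀ {P} → Unique P → All (IsComponent W F) P → Disjoint P
  disjoint []       []       = []
  disjoint (S∉ ∷ u) (CS ∷ CP) =
    All.tabulate (λ {T} T∈ (x , x∈) → let x∈S , x∈T = x∈p∩q⁻ _ T x∈ in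
      All.lookup S∉ T∈ (isComponent-unique CS (All.lookup CP T∈) x∈S x∈T))
    ∷ disjoint u CP

_≟ᴾ_ : DecidableEquality (List (Subset n))
_≟ᴾ_ = List.≡-dec _≟ˢ_

EdgesIn : Subset n → List (Edge n) → Set
EdgesIn W F = ∀ {a b} → (a , b) ∈ F → a Subset.∈ W × b Subset.∈ W

conn-⇂⇒conn : (F : List (Edge n)) (S : Subset n) → Connected (F ⇂ S) x y → Connected F x y
conn-⇂⇒conn F S = conn-bind (edge⇒conn ∘ proj₁ ∘ ∈-filter⁻ (_⊆ᵉ? S) {xs = F})

-- No edge of `F` leaves `S`, so a walk starting in `S` uses only edges inside `S`. Membership and
-- connection are carried along the walk together.
conn⇒conn-⇂ : (S : Subset n) → (∀ {a b} → (a , b) ∈ F → a Subset.∈ S ⇔ b Subset.∈ S) →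
              x Subset.∈ S → Connected F x y → y Subset.∈ S × Connected (F ⇂ S) x y
conn⇒conn-⇂ {F = F} {x = x} S closed x∈S c =
  conn-preserves (λ z → z Subset.∈ S × Connected (F ⇂ S) x z) step c (x∈S , ε)
  where
  step : ∀ {a b} → (a , b) ∈ F → (a Subset.∈ S × Connected (F ⇂ S) x a) ⇔
                                   (b Subset.∈ S × Connected (F ⇂ S) x b)
  step ab∈ = mk⇔
    (λ (a∈S , xa) → let b∈S = to (closed ab∈) a∈S in
      b∈S , xa ⨾ edge⇒conn (∈-filter⁺ (_⊆ᵉ? S) ab∈ (a∈S , b∈S)))
    (λ (b∈S , xb) → let a∈S = from (closed ab∈) b∈S in
      a∈S , xb ⨾ conn-sym (edge⇒conn (∈-filter⁺ (_⊆ᵉ? S) ab∈ (a∈S , b∈S))))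

isComponent-closed : EdgesIn W F → IsComponent W F S →
                     ∀ {a b} → (a , b) ∈ F → a Subset.∈ S ⇔ b Subset.∈ S
isComponent-closed F⊆W CS ab∈ = mk⇔
  (λ a∈S → from (isComponent-∋ CS a∈S _) (proj₂ (F⊆W ab∈) , edge⇒conn ab∈))
  (λ b∈S → from (isComponent-∋ CS b∈S _) (proj₁ (F⊆W ab∈) , conn-sym (edge⇒conn ab∈)))

-- Walks from a vertex of a component stay inside it, so `F ⇂ S` still connects all of `S`.
k-⇂-component : EdgesIn W F → IsComponent W F S → k S (F ⇂ S) ≡ 1
k-⇂-component {F = F} {S} F⊆W CS = k≡1⁺ λ T → mk⇔ ⇒ (λ { refl → isS })
  where
  isS : IsComponent S (F ⇂ S) S
  isS = let r , r∈S = isComponent-nonempty CS in r , r∈S , λ y → mk⇔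
    (λ y∈S → y∈S , proj₂ (conn⇒conn-⇂ S (isComponent-closed F⊆W CS) r∈S
                            (proj₂ (to (isComponent-∋ CS r∈S y) y∈S))))
    proj₁
  ⇒ : IsComponent S (F ⇂ S) T → T ≡ S
  ⇒ CT = let r , r∈T = isComponent-nonempty CT in
    isComponent-unique CT isS r∈T (isComponent-⊆ CT r∈T)

all-inBlock-components : EdgesIn W F → All (InBlock (components W F)) F
all-inBlock-components {F = F} F⊆W = All.tabulate λ ab∈ →
  let a∈W , b∈W = F⊆W ab∈ in
  lose (from (∈-components F) (isComponent-component F a∈W))
       (x∈component F a∈W , from (∈-component F) (b∈W , edge⇒conn ab∈))

-- The block containing the edge meets `S` in an endpoint, hence is `S` by disjointness.
inBlock-closed : ∀ {P : List (Subset n)} → Disjoint P → All (InBlock P) F → S ∈ P →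
                 ∀ {a b} → (a , b) ∈ F → a Subset.∈ S ⇔ b Subset.∈ S
inBlock-closed {S = S} disjoint F⊆P S∈ {a} {b} ab∈ with find (All.lookup F⊆P ab∈)
... | T , T∈ , a∈T , b∈T = mk⇔
  (λ a∈S → subst (b Subset.∈_) (disjoint⇒≡ disjoint T∈ S∈ a∈T a∈S) b∈T)
  (λ b∈S → subst (a Subset.∈_) (disjoint⇒≡ disjoint T∈ S∈ b∈T b∈S) a∈T)

-- A block is connected by its own edges and no edge leaves it, so it is a full component; as the
-- blocks cover `W`, every component meets a block and equals it.
components-≡ : ∀ {m} {P : List (Subset n)} → P ⊆ allSubsets n → IsDecomposition W m P →
  All (InBlock P) F → All (λ S → k S (F ⇂ S) ≡ 1) P → components W F ≡ P
components-≡ {n} {W} {F} {P = P} P⊆ D F⊆P k≡1 =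
  ⊆-filter-≡ (isComponent? W F) (Unique-allSubsets n) P⊆ (λ _ → mk⇔ ⇒ ⇐)
  where
  open IsDecomposition D
  ⇒ : S ∈ P → IsComponent W F S
  ⇒ {S} S∈ = let r , r∈S = All.lookup nonempty S∈ in r , ∈W S∈ r∈S , λ y → mk⇔
    (λ y∈S → ∈W S∈ y∈S , conn-⇂⇒conn F S (k≡1⁻ (All.lookup k≡1 S∈) r∈S y∈S))
    (λ (_ , ry) → proj₁ (conn⇒conn-⇂ S (inBlock-closed disjoint F⊆P S∈) r∈S ry))
    where
    ∈W : S ∈ P → x Subset.∈ S → x Subset.∈ W
    ∈W S∈ x∈S = subst (_ Subset.∈_) cover (from (∈-⋃ P) (lose S∈ x∈S))
  ⇐ : IsComponent W F T → T ∈ P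
  ⇐ CT with isComponent-nonempty CT
  ... | r , r∈T with find (to (∈-⋃ P) (subst (r Subset.∈_) (sym cover) (isComponent-⊆ CT r∈T)))
  ...   | S , S∈ , r∈S = subst (_∈ P) (isComponent-unique (⇒ S∈) CT r∈S r∈T) S∈

-- The left side is nonzero only if every edge of `F` lies in a block and every block is connected
-- by its edges, that is, if `P` lists the components of `F`. Then each edge is counted in exactly
-- one block and the signs multiply to `sgn F`.
∏-components : ∀ {m} {P : List (Subset n)} → P ⊆ allSubsets n → IsDecomposition W m P → EdgesIn W F →
  𝟙 (all? (inBlock? P) F) * ∏ P (λ S → 𝟙 (k S (F ⇂ S) ℕ.≟ 1) * sgn (F ⇂ S)) ≡
  𝟙 (components W F ≟ᴾ P) * sgn F
∏-components {W = W} {F} {P = P} P⊆ D F⊆W with components W F ≟ᴾ P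
... | yes refl = begin
  𝟙 (all? (inBlock? P) F) * ∏ P (λ S → 𝟙 (k S (F ⇂ S) ℕ.≟ 1) * sgn (F ⇂ S))
    ≡⟨ 𝟙-yes-* (all? (inBlock? P) F) F⊆P _ ⟩
  ∏ P (λ S → 𝟙 (k S (F ⇂ S) ℕ.≟ 1) * sgn (F ⇂ S))
    ≡⟨ ∏-cong P (λ {S} S∈ →
         𝟙-yes-* (k S (F ⇂ S) ℕ.≟ 1) (k-⇂-component F⊆W (to (∈-components F) S∈)) _) ⟩
  ∏ P (λ S → sgn (F ⇂ S))
    ≡⟨ ∏-sgn (IsDecomposition.disjoint D) F ⟩
  sgn (filter (inBlock? P) F)
    ≡⟨ cong sgn (filter-all (inBlock? P) F⊆P) ⟩
  sgn F
    ≡⟨ *-identityˡ (sgn F) ⟨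
  1ℤ * sgn F ∎
  where
  F⊆P : All (InBlock P) F
  F⊆P = all-inBlock-components F⊆W
... | no C≢P with all? (inBlock? P) F
...   | no _ = trans (*-zeroˡ (∏ P λ S → 𝟙 (k S (F ⇂ S) ℕ.≟ 1) * sgn (F ⇂ S))) (sym (*-zeroˡ (sgn F)))
...   | yes F⊆P with all? (λ S → k S (F ⇂ S) ℕ.≟ 1) P
...     | yes k≡1 = contradiction (components-≡ P⊆ D F⊆P k≡1) C≢P
-- One block that is not connected by its own edges already annihilates the product.
...     | no ¬k≡1 with find (¬All⇒Any¬ (λ S → k S (F ⇂ S) ℕ.≟ 1) P ¬k≡1)
...       | S , S∈ , k≢1 = trans
  (cong (1ℤ *_) (∏-zero S∈ (𝟙-no-* (k S (F ⇂ S) ℕ.≟ 1) k≢1 (sgn (F ⇂ S)))))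
  (sym (*-zeroˡ (sgn F)))

-- Edge sets separating the endpoints of e

module _ (G : Graph n) (e : Edge n) (e∈E : e ∈ E G) (i : ℕ) where

  private
    u∈V = proj₁ (proj₂ (E-valid G e∈E))
    v∈V = proj₂ (proj₂ (E-valid G e∈E))

    edgesIn : F ⊆ E G → EdgesIn (V G) F
    edgesIn τ ab∈ = proj₂ (E-valid G (lookup τ ab∈))

    -- What is left of a set with `i` components and bridge `e` once `e` is deleted, whence the
    -- `suc`.
    Separating : List (Edge n) → Set
    Separating F = k (V G) F ≡ suc i × ¬ Connected F (proj₁ e) (proj₂ e)

    separating? : U.Decidable Separating
    separating? F = (k (V G) F ℕ.≟ suc i) ×-dec ¬? (connected? F (proj₁ e) (proj₂ e))

    bridge? : U.Decidable (λ F → IsBridge (V G) e F × k (V G) F ≡ i)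
    bridge? F = isBridge? (V G) e F ×-dec (k (V G) F ℕ.≟ i)

    Admissible : List (Subset n) → Set
    Admissible P = IsDecomposition (V G) (suc i) P × All (λ S → e ∉ E (G ⟦ S ⟧)) P

    admissible? : U.Decidable Admissible
    admissible? P = isDecomposition? (V G) (suc i) P ×-dec all? (λ S → ¬? (e ∈ₑ? E (G ⟦ S ⟧))) P

  -- If the endpoints stayed connected in `F ∖ e`, the count could not rise; if they do not, it
  -- rises by exactly one.
  bridge⇔separating : e ∈ F → (IsBridge (V G) e F × k (V G) F ≡ i) ⇔ Separating (F ∖ e)
  bridge⇔separating {F} e∈F = mk⇔
    (λ ((_ , k∖) , k≡i) → let k∖′ = trans k∖ (ℕ.+-comm (k (V G) F) 1) in
      trans k∖′ (cong suc k≡i) ,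
      λ uv → ℕ.1+n≢n (trans (sym k∖′) (k-∖-connected (V G) uv)))
    (λ (k∖ , ¬uv) → let k∖′ = k-∖-disconnected e∈F u∈V v∈V ¬uv in
      (e∈F , trans k∖′ (ℕ.+-comm 1 (k (V G) F))) , ℕ.suc-injective (trans (sym k∖′) k∖))

  b≡-separating : b G e i ≡ - ∑ (subsets (E G)) (λ F → 𝟙 (separating? F) * sgn F)
  b≡-separating = trans (∑-filter bridge? (subsets (E G)) sgn)
    (∑-subsets-∖ (λ F → 𝟙 (bridge? F) * sgn F) (λ F → 𝟙 (separating? F) * sgn F) (E-unique G) e∈E
      -- The supports are as required: a bridge of `F` belongs to `F`, while a set containing `e`
      -- connects the endpoints of `e`.
      (λ {F} _ e∉F → 𝟙-no-* (bridge? F) (e∉F ∘ proj₁ ∘ proj₁) (sgn F))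
      (λ {F} _ e∈F → 𝟙-no-* (separating? F) (λ (_ , ¬uv) → ¬uv (edge⇒conn e∈F)) (sgn F))
      (λ {F} τ e∈F → trans
        (cong₂ _*_ (𝟙-⇔ (bridge? F) (separating? (F ∖ e)) (bridge⇔separating e∈F))
                   (sgn-∖ (Unique-⊆ τ (E-unique G)) e∈F))
        (lemma (𝟙 (separating? (F ∖ e))) (sgn (F ∖ e)))))
    where
    lemma : ∀ a b → a * - b ≡ - (a * b)
    lemma = solve-∀

  -- The components always form a decomposition, so only its size and `e` matter; since `e` is an
  -- edge of `G`, it lies in an induced block exactly when its endpoints share a component.
  admissible⇔separating : Admissible (components (V G) F) ⇔ Separating F
  admissible⇔separating {F} = mk⇔
    (λ (D , e∉) → IsDecomposition.size D , λ uv →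
      All.lookup e∉ (from (∈-components F) (isComponent-component F u∈V))
        (∈-filter⁺ (_⊆ᵉ? _) e∈E (x∈component F u∈V , from (∈-component F) (v∈V , uv))))
    (λ (k≡ , ¬uv) → subst (λ m → IsDecomposition (V G) m (components (V G) F)) k≡
                          (components-decomposition (V G) F) ,
      All.tabulate λ {S} S∈ e∈S → let u∈S , v∈S = proj₂ (∈-filter⁻ (_⊆ᵉ? S) {xs = E G} e∈S) in
        ¬uv (proj₂ (to (isComponent-∋ (to (∈-components F) S∈) u∈S _) v∈S)))

  ∏-a₁ : ∀ {P m} → P ⊆ allSubsets n → IsDecomposition (V G) m P →
         ∏ P (λ S → a₁ (G ⟦ S ⟧)) ≡ ∑ (subsets (E G)) (λ F → 𝟙 (components (V G) F ≟ᴾ P) * sgn F)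
  ∏-a₁ {P} P⊆ D = begin
    ∏ P (λ S → a₁ (G ⟦ S ⟧))
      -- The edge list of `G ⟦ S ⟧` is `E G ⇂ S` by definition.
      ≡⟨ ∏-cong P (λ {S} _ → ∑-filter (λ F → k S F ℕ.≟ 1) (subsets (E G ⇂ S)) sgn) ⟩
    ∏ P (λ S → ∑ (subsets (E G ⇂ S)) (λ F → 𝟙 (k S F ℕ.≟ 1) * sgn F))
      ≡⟨ ∏-∑-subsets (IsDecomposition.disjoint D) (λ S F → 𝟙 (k S F ℕ.≟ 1) * sgn F) (E G) ⟩
    ∑ (subsets (filter (inBlock? P) (E G))) (λ F → ∏ P (λ S → 𝟙 (k S (F ⇂ S) ℕ.≟ 1) * sgn (F ⇂ S)))
      ≡⟨ ∑-subsets-filter (inBlock? P) (E G) _ ⟩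
    ∑ (subsets (E G)) (λ F →
      𝟙 (all? (inBlock? P) F) * ∏ P (λ S → 𝟙 (k S (F ⇂ S) ℕ.≟ 1) * sgn (F ⇂ S)))
      ≡⟨ ∑-cong (subsets (E G)) (λ F∈ → ∏-components P⊆ D (edgesIn (∈-subsets⁻ (E G) F∈))) ⟩
    ∑ (subsets (E G)) (λ F → 𝟙 (components (V G) F ≟ᴾ P) * sgn F) ∎

  decompositions≡separating : ∑ (decompositions G (suc i) e) (λ P → ∏ P (λ S → a₁ (G ⟦ S ⟧))) ≡
                              ∑ (subsets (E G)) (λ F → 𝟙 (separating? F) * sgn F)
  decompositions≡separating = begin
    ∑ (decompositions G (suc i) e) (λ P → ∏ P (λ S → a₁ (G ⟦ S ⟧)))
      ≡⟨ ∑-filter admissible? Ps _ ⟩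
    ∑ Ps (λ P → 𝟙 (admissible? P) * ∏ P (λ S → a₁ (G ⟦ S ⟧)))
      ≡⟨ ∑-cong Ps expand ⟩
    ∑ Ps (λ P → ∑ Fs (λ F → 𝟙 (admissible? P) * (𝟙 (components (V G) F ≟ᴾ P) * sgn F)))
      ≡⟨ ∑-swap Ps Fs _ ⟩
    ∑ Fs (λ F → ∑ Ps (λ P → 𝟙 (admissible? P) * (𝟙 (components (V G) F ≟ᴾ P) * sgn F)))
      ≡⟨ ∑-cong Fs (λ {F} _ → collapse F) ⟩
    ∑ Fs (λ F → 𝟙 (separating? F) * sgn F) ∎
    where
    Ps = subsets (allSubsets n)
    Fs = subsets (E G)

    expand : ∀ {P} → P ∈ Ps → 𝟙 (admissible? P) * ∏ P (λ S → a₁ (G ⟦ S ⟧)) ≡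
                               ∑ Fs (λ F → 𝟙 (admissible? P) * (𝟙 (components (V G) F ≟ᴾ P) * sgn F))
    expand {P} P∈ = trans
      (𝟙-*-cong (admissible? P) λ (D , _) → ∏-a₁ (∈-subsets⁻ (allSubsets n) P∈) D)
      (sym (∑-*ˡ Fs (𝟙 (admissible? P)) λ F → 𝟙 (components (V G) F ≟ᴾ P) * sgn F))

    -- Only `P = components (V G) F` contributes, and it occurs once in `Ps`; its admissibility is
    -- the separation property of `F`.
    collapse : ∀ F → ∑ Ps (λ P → 𝟙 (admissible? P) * (𝟙 (components (V G) F ≟ᴾ P) * sgn F)) ≡
                     𝟙 (separating? F) * sgn F
    collapse F = trans
      (∑-pick (Unique-subsets (Unique-allSubsets n)) (∈-subsets⁺ (filter-⊆ (isComponent? (V G) F) (allSubsets n)))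
        λ {P} _ P≢C → trans (cong (𝟙 (admissible? P) *_)
                              (𝟙-no-* (components (V G) F ≟ᴾ P) (P≢C ∘ sym) (sgn F)))
                            (*-zeroʳ (𝟙 (admissible? P))))
      (cong₂ _*_ (𝟙-⇔ (admissible? (components (V G) F)) (separating? F) admissible⇔separating)
                 (𝟙-yes-* (components (V G) F ≟ᴾ components (V G) F) refl (sgn F)))

lemma2p5 : ∀ {n : ℕ} (G : Graph n) → Nonempty (V G) → E G ≢ [] →
    ∀ e → e ∈ E G → ∀ (i : ℕ) → 1 ≤ i →
    b G e i ≡ - ∑ (decompositions G (suc i) e) (λ P → ∏ P (λ S → a₁ (G ⟦ S ⟧)))
lemma2p5 G _ _ e e∈E i _ = trans (b≡-separating G e e∈E i)
  (cong -_ (sym (decompositions≡separating G e e∈E i)))
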